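{- (1) For every $n\ge1$, $(\mathcal{Q}_n,\le)$ is a lattice. (2) For every $n\ge3$, $(\mathcal{P}_n,\le)$ is not a lattice. (3) For every $n\ge4$, $\mathcal{Q}_n\setminus\mathcal{P}_n$ with the induced order is not a lattice.
   Context: Fix $n\ge1$, $L_n=\{0,1,\dots,n\}$. A discrete quasi-copula is a map $Q:L_n\times L_n\to[0,n]$ such that (Q1) $Q(i,0)=Q(0,i)=0$ and $Q(i,n)=Q(n,i)=i$ for all $i\in L_n$; (Q2) $Q$ is non-decreasing in each argument; (Q3) $Q(i,j)+Q(i',j')\ge Q(i,j')+Q(i',j)$ for all $i\le i'$, $j\le j'$ in $L_n$ such that at least one of $i,i',j,j'$ is $0$ or $n$. A discrete copula is a map satisfying (Q1) and the 2-increasing inequality $Q(i,j)+Q(i',j')\ge Q(i,j')+Q(i',j)$ for all $i\le i'$, $j\le j'$ in $L_n$. Such a map is irreducible if its range is exactly $L_n$. $\mathcal{Q}_n$ (resp. $\mathcal{P}_n$) is the set of irreducible discrete quasi-copulas (resp. copulas) on $L_n$, ordered by the concordance order $P\le Q$ iff $P(i,j)\le Q(i,j)$ for all $i,j\in L_n$; $\mathcal{P}_n\subseteq\mathcal{Q}_n$ and subsets carry the induced order. -}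

module Defs where

open import Level using (0ℓ)
open import Data.Nat.Base using (ℕ; suc)
open import Data.Integer.Base using (+_)
open import Data.Fin.Base as Fin using (Fin; zero; fromℕ; toℕ)
open import Data.Rational.Base as ℚ using (ℚ; 0ℚ; _/_; _+_)
import Data.Rational.Properties as ℚ
open import Data.Product.Base using (∃; ∃₂; _×_; proj₁)
open import Data.Sum.Base using (_⊎_)
open import Function.Bundles using (_⇔_)
open import Relation.Binary.Bundles using (Poset)
open import Relation.Binary.Lattice.Structures using (IsLattice)
import Relation.Binary.Construct.On as On
open import Relation.Binary.PropositionalEquality.Core using (_≡_; refl; sym; trans)
open import Relation.Unary using (Pred; _∩_)

L : ℕ → Set
L n = Fin (suc n)

-- The real interval [0,n] is rendered by its rational points. No map of
-- interest is lost: an irreducible map takes all its values in L n.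
Map : ℕ → Set
Map n = L n → L n → ℚ

val : ∀ {n} → L n → ℚ
val k = + toℕ k / 1

Bounded : ∀ {n} → Pred (Map n) 0ℓ
Bounded {n} Q = ∀ i j → 0ℚ ℚ.≤ Q i j × Q i j ℚ.≤ (+ n / 1)

record BoundaryConditions {n} (Q : Map n) : Set where
  field
    zeroʳ : ∀ i → Q i zero ≡ 0ℚ
    zeroˡ : ∀ i → Q zero i ≡ 0ℚ
    topʳ  : ∀ i → Q i (fromℕ n) ≡ val i
    topˡ  : ∀ i → Q (fromℕ n) i ≡ val i

Monotone : ∀ {n} → Pred (Map n) 0ℓ
Monotone {n} Q =
    (∀ (i i′ j : L n) → i Fin.≤ i′ → Q i j ℚ.≤ Q i′ j)
  × (∀ (i j j′ : L n) → j Fin.≤ j′ → Q i j ℚ.≤ Q i j′)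

RectangleInequality : ∀ {n} → Map n → (i i′ j j′ : L n) → Set
RectangleInequality Q i i′ j j′ = Q i j + Q i′ j′ ℚ.≥ Q i j′ + Q i′ j

Extreme : ∀ {n} → Pred (L n) 0ℓ
Extreme {n} i = i ≡ zero ⊎ i ≡ fromℕ n

record IsDiscreteQuasiCopula {n} (Q : Map n) : Set where
  field
    bounded  : Bounded Q
    boundary : BoundaryConditions Q
    monotone : Monotone Q
    boundary-2-increasing : ∀ (i i′ j j′ : L n) → i Fin.≤ i′ → j Fin.≤ j′ →
      Extreme i ⊎ Extreme i′ ⊎ Extreme j ⊎ Extreme j′ →
      RectangleInequality Q i i′ j j′

record IsDiscreteCopula {n} (Q : Map n) : Set where
  field
    bounded  : Bounded Q
    boundary : BoundaryConditions Q
    2-increasing : ∀ (i i′ j j′ : L n) → i Fin.≤ i′ → j Fin.≤ j′ →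
      RectangleInequality Q i i′ j j′

IsIrreducible : ∀ {n} → Pred (Map n) 0ℓ
IsIrreducible {n} Q =
  ∀ q → (∃₂ λ i j → Q i j ≡ q) ⇔ (∃ λ (k : L n) → val k ≡ q)

𝒬 : ∀ n → Pred (Map n) 0ℓ
𝒬 n = IsDiscreteQuasiCopula ∩ IsIrreducible

𝒫 : ∀ n → Pred (Map n) 0ℓ
𝒫 n = IsDiscreteCopula ∩ IsIrreducible

-- Maps are identified when they agree pointwise.
concordance : ℕ → Poset 0ℓ 0ℓ 0ℓ
concordance n = record
  { Carrier = Map n
  ; _≈_ = λ P Q → ∀ i j → P i j ≡ Q i j
  ; _≤_ = λ P Q → ∀ i j → P i j ℚ.≤ Q i j
  ; isPartialOrder = record
    { isPreorder = record
      { isEquivalence = record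
        { refl  = λ i j → refl
        ; sym   = λ p i j → sym (p i j)
        ; trans = λ p q i j → trans (p i j) (q i j)
        }
      ; reflexive = λ p i j → ℚ.≤-reflexive (p i j)
      ; trans = λ p q i j → ℚ.≤-trans (p i j) (q i j)
      }
    ; antisym = λ p q i j → ℚ.≤-antisym (p i j) (q i j)
    }
  }

induced : ∀ {n} → Pred (Map n) 0ℓ → Poset 0ℓ 0ℓ 0ℓ
induced {n} S = On.poset (concordance n) (proj₁ {A = Map n} {B = S})

Lattice : Poset 0ℓ 0ℓ 0ℓ → Set
Lattice P = ∃₂ λ _∨_ _∧_ → IsLattice _≈_ _≤_ _∨_ _∧_
  where open Poset P

{-# OPTIONS --safe #-}
-- (1) A map satisfying the boundary conditions is a quasi-copula iff it is monotone and
-- 1-Lipschitz in each argument, and both properties survive pointwise maxima and minima.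
--
-- (2), (3) If a, b ≤ c, d and the pointwise maximum of a and b equals the pointwise minimum
-- of c and d, then a join of a and b can only be that common map p. So a class is not a
-- lattice as soon as it contains such a, b, c, d but not p. All the maps used are obtained
-- from the largest copula min(i,j) by lowering it by 1 on a small set of points, which makes
-- them independent of n.
module Submission where

open import Defs
open import Data.Nat.Base using (ℕ; _≥_)
open import Data.Product.Base using (_×_)
open import Relation.Nullary.Negation.Core using (¬_)
open import Relation.Unary using (_∖_)

open import Level using (0ℓ)
open import Data.Bool.Base using (if_then_else_; true; false)
open import Data.Fin.Base as Fin using (Fin; zero; fromℕ; fromℕ<; toℕ)
import Data.Fin.Properties as Fin
open import Data.Integer.Base as ℤ using (+_; +≤+)
import Data.Integer.Properties as ℤ
open import Data.List.Base using (List; []; _∷_)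
open import Data.List.Relation.Unary.All as All using (All)
open import Data.Nat.Base using (suc; pred; _+_; _⊓_; _≤_; _<_; z≤n; s≤s; _≤′_; ≤′-refl; ≤′-step)
import Data.Nat.Properties as ℕ
open import Data.Nat.Tactic.RingSolver using (solve-∀)
open import Data.Product.Base using (∃; ∃₂; _,_; proj₁; proj₂)
open import Data.Product.Properties using (≡-dec)
open import Data.Rational.Base as ℚ using (ℚ; 0ℚ; _/_; toℚᵘ)
import Data.Rational.Properties as ℚ
open import Data.Rational.Unnormalised.Base as ℚᵘ using (mkℚᵘ; *≡*; *≤*)
import Data.Rational.Unnormalised.Properties as ℚᵘ
open import Data.Sum.Base as Sum using (_⊎_; inj₁; inj₂)
open import Function.Base using (_∘_; flip; case_of_)
open import Function.Bundles using (mk⇔; module Equivalence)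
open import Relation.Binary.Bundles using (Poset)
open import Relation.Binary.Lattice.Structures using (IsLattice)
open import Relation.Binary.PropositionalEquality
  using (_≡_; refl; sym; trans; cong; cong₂; subst; subst₂)
open import Relation.Nullary.Decidable
  using (Dec; does; yes; no; from-yes; dec-true; dec-false; _×-dec_; _⊎-dec_; _→-dec_; ¬?; map′)
open import Relation.Unary using (Pred; Decidable)
open import Data.List.Membership.DecPropositional (≡-dec ℕ._≟_ ℕ._≟_) using (_∈_; _∉_; _∈?_)

-- Natural numbers inside the rationals

ι : ℕ → ℚ
ι a = + a / 1

-- `_/_` normalises its result, so the comparison is made in the unnormalised rationals, where both
-- sides are fractions with denominator 1.
ι-+ : ∀ a b → ι a ℚ.+ ι b ≡ ι (a + b)
ι-+ a b = ℚ.toℚᵘ-injective (begin-equality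
  toℚᵘ (ι a ℚ.+ ι b)              ≃⟨ ℚ.toℚᵘ-homo-+ (ι a) (ι b) ⟩
  toℚᵘ (ι a) ℚᵘ.+ toℚᵘ (ι b)      ≃⟨ ℚᵘ.+-cong (ℚ.toℚᵘ-fromℚᵘ (mkℚᵘ (+ a) 0)) (ℚ.toℚᵘ-fromℚᵘ (mkℚᵘ (+ b) 0)) ⟩
  mkℚᵘ (+ a) 0 ℚᵘ.+ mkℚᵘ (+ b) 0  ≃⟨ *≡* (cong (ℤ._* + 1) (cong₂ ℤ._+_ (ℤ.*-identityʳ (+ a)) (ℤ.*-identityʳ (+ b)))) ⟩
  mkℚᵘ (+ (a + b)) 0              ≃⟨ ℚ.toℚᵘ-fromℚᵘ (mkℚᵘ (+ (a + b)) 0) ⟨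
  toℚᵘ (ι (a + b))                ∎)
  where open ℚᵘ.≤-Reasoning

ι-mono-≤ : ∀ a b → a ≤ b → ι a ℚ.≤ ι b
ι-mono-≤ a b a≤b = ℚ.toℚᵘ-cancel-≤ (begin
  toℚᵘ (ι a)    ≃⟨ ℚ.toℚᵘ-fromℚᵘ (mkℚᵘ (+ a) 0) ⟩
  mkℚᵘ (+ a) 0  ≤⟨ *≤* (ℤ.*-monoʳ-≤-nonNeg (+ 1) (+≤+ a≤b)) ⟩
  mkℚᵘ (+ b) 0  ≃⟨ ℚ.toℚᵘ-fromℚᵘ (mkℚᵘ (+ b) 0) ⟨
  toℚᵘ (ι b)    ∎)
  where open ℚᵘ.≤-Reasoning

ι-cancel-≤ : ∀ {a b} → ι a ℚ.≤ ι b → a ≤ b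
ι-cancel-≤ {a} {b} ιa≤ιb = case le of λ where
    (*≤* a*1≤b*1) → ℤ.drop‿+≤+ (ℤ.*-cancelʳ-≤-pos (+ a) (+ b) (+ 1) a*1≤b*1)
  where
  open ℚᵘ.≤-Reasoning
  le : mkℚᵘ (+ a) 0 ℚᵘ.≤ mkℚᵘ (+ b) 0
  le = begin
    mkℚᵘ (+ a) 0  ≃⟨ ℚ.toℚᵘ-fromℚᵘ (mkℚᵘ (+ a) 0) ⟨
    toℚᵘ (ι a)    ≤⟨ ℚ.toℚᵘ-mono-≤ ιa≤ιb ⟩
    toℚᵘ (ι b)    ≃⟨ ℚ.toℚᵘ-fromℚᵘ (mkℚᵘ (+ b) 0) ⟩
    mkℚᵘ (+ b) 0  ∎

ι-mono-+-≤ : ∀ a b c d → a + b ≤ c + d → ι a ℚ.+ ι b ℚ.≤ ι c ℚ.+ ι d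
ι-mono-+-≤ a b c d le = subst₂ ℚ._≤_ (sym (ι-+ a b)) (sym (ι-+ c d)) (ι-mono-≤ (a + b) (c + d) le)

ι-cancel-+-≤ : ∀ a b c d → ι a ℚ.+ ι b ℚ.≤ ι c ℚ.+ ι d → a + b ≤ c + d
ι-cancel-+-≤ a b c d le = ι-cancel-≤ (subst₂ ℚ._≤_ (ι-+ a b) (ι-+ c d) le)

-- Quasi-copulas as Lipschitz maps

-- Written without subtraction, with the summands ordered as in the rectangle inequality for
-- `j′ = n` or `i′ = n`, so that `topʳ` and `topˡ` turn one into the other.
Lipschitz : ∀ {n} → Pred (Map n) 0ℓ
Lipschitz {n} Q =
    (∀ (i i′ j : L n) → i Fin.≤ i′ → val i ℚ.+ Q i′ j ℚ.≤ Q i j ℚ.+ val i′)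
  × (∀ (i j j′ : L n) → j Fin.≤ j′ → Q i j′ ℚ.+ val j ℚ.≤ Q i j ℚ.+ val j′)

quasiCopula⇒Lipschitz : ∀ {n} {Q : Map n} → IsDiscreteQuasiCopula Q → Lipschitz Q
quasiCopula⇒Lipschitz {n} {Q} q =
    (λ i i′ j i≤i′ → subst₂ (λ x y → x ℚ.+ Q i′ j ℚ.≤ Q i j ℚ.+ y) (topʳ i) (topʳ i′)
      (boundary-2-increasing i i′ j (fromℕ n) i≤i′ (Fin.≤fromℕ j) (inj₂ (inj₂ (inj₂ (inj₂ refl))))))
  , (λ i j j′ j≤j′ → subst₂ (λ x y → Q i j′ ℚ.+ x ℚ.≤ Q i j ℚ.+ y) (topˡ j) (topˡ j′)
      (boundary-2-increasing i (fromℕ n) j j′ (Fin.≤fromℕ i) j≤j′ (inj₂ (inj₁ (inj₂ refl)))))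
  where
  open IsDiscreteQuasiCopula q
  open BoundaryConditions boundary

-- An interval whose lower end is `n` or whose upper end is 0 consists of one point, so the extreme
-- end can be taken on its own side.
extreme-ends : ∀ {n} {i i′ : L n} → i Fin.≤ i′ → Extreme i ⊎ Extreme i′ → i ≡ zero ⊎ i′ ≡ fromℕ n
extreme-ends i≤i′ (inj₁ (inj₁ i≡0)) = inj₁ i≡0
extreme-ends {i′ = i′} i≤i′ (inj₁ (inj₂ refl)) = inj₂ (Fin.≤-antisym (Fin.≤fromℕ i′) i≤i′)
extreme-ends i≤i′ (inj₂ (inj₁ refl)) = inj₁ (Fin.≤-antisym i≤i′ z≤n)
extreme-ends i≤i′ (inj₂ (inj₂ i′≡n)) = inj₂ i′≡n

-- A rectangle with a side on a zero edge reduces to monotonicity, because the values there vanish;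
-- one with a side on a top edge reduces to the Lipschitz condition, because the values there are
-- indices.
Lipschitz⇒quasiCopula : ∀ {n} {Q : Map n} → Bounded Q → BoundaryConditions Q →
  Monotone Q → Lipschitz Q → IsDiscreteQuasiCopula Q
Lipschitz⇒quasiCopula {n} {Q} bounded boundary monotone (lipˡ , lipʳ) = record
  { bounded = bounded
  ; boundary = boundary
  ; monotone = monotone
  ; boundary-2-increasing = λ i i′ j j′ i≤i′ j≤j′ →
      Sum.[ rows i≤i′ j≤j′ ∘ extreme-ends i≤i′
          , columns i≤i′ j≤j′ ∘ extreme-ends j≤j′
          ]′ ∘ Sum.assocˡ
  }
  where
  open BoundaryConditions boundary
  rows : ∀ {i i′ j j′} → i Fin.≤ i′ → j Fin.≤ j′ → i ≡ zero ⊎ i′ ≡ fromℕ n →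
    RectangleInequality Q i i′ j j′
  rows {i} {i′} {j} {j′} _ j≤j′ (inj₁ refl) = ℚ.+-mono-≤
    (ℚ.≤-reflexive (trans (zeroˡ j′) (sym (zeroˡ j)))) (proj₂ monotone i′ j j′ j≤j′)
  rows {i} {i′} {j} {j′} _ j≤j′ (inj₂ refl) =
    subst₂ (λ x y → Q i j′ ℚ.+ x ℚ.≤ Q i j ℚ.+ y) (sym (topˡ j)) (sym (topˡ j′)) (lipʳ i j j′ j≤j′)
  columns : ∀ {i i′ j j′} → i Fin.≤ i′ → j Fin.≤ j′ → j ≡ zero ⊎ j′ ≡ fromℕ n →
    RectangleInequality Q i i′ j j′
  columns {i} {i′} {j} {j′} i≤i′ _ (inj₁ refl) =
    subst (ℚ._≤ Q i zero ℚ.+ Q i′ j′) (ℚ.+-comm (Q i′ zero) (Q i j′)) (ℚ.+-mono-≤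
      (ℚ.≤-reflexive (trans (zeroʳ i′) (sym (zeroʳ i)))) (proj₁ monotone i i′ j′ i≤i′))
  columns {i} {i′} {j} {j′} i≤i′ _ (inj₂ refl) =
    subst₂ (λ x y → x ℚ.+ Q i′ j ℚ.≤ Q i j ℚ.+ y) (sym (topʳ i)) (sym (topʳ i′)) (lipˡ i i′ j i≤i′)

-- Pointwise maxima and minima

-- One argument serves both lattice operations: `sel` carries over properties of single values,
-- `mono` carries over inequalities, and `shift` moves the added constants of the Lipschitz
-- condition across `_∙_`.
module Pointwise
  (_∙_ : ℚ → ℚ → ℚ)
  (sel : ∀ p q → p ∙ q ≡ p ⊎ p ∙ q ≡ q)
  (mono : ∀ {p p′ q q′} → p ℚ.≤ p′ → q ℚ.≤ q′ → p ∙ q ℚ.≤ p′ ∙ q′)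
  (shift : ∀ {f : ℚ → ℚ} → (∀ {p q} → p ℚ.≤ q → f p ℚ.≤ f q) → ∀ p q → f (p ∙ q) ≡ f p ∙ f q)
  where

  pointwise : ∀ {n} → Map n → Map n → Map n
  pointwise P Q i j = P i j ∙ Q i j

  ∙-elim : ∀ {p q} (X : ℚ → Set) → X p → X q → X (p ∙ q)
  ∙-elim {p} {q} X xp xq with sel p q
  ... | inj₁ eq = subst X (sym eq) xp
  ... | inj₂ eq = subst X (sym eq) xq

  monotone-∙ : ∀ {n} {P Q : Map n} → Monotone P → Monotone Q → Monotone (pointwise P Q)
  monotone-∙ (mˡ , mʳ) (mˡ′ , mʳ′) =
      (λ i i′ j le → mono (mˡ i i′ j le) (mˡ′ i i′ j le))
    , (λ i j j′ le → mono (mʳ i j j′ le) (mʳ′ i j j′ le))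

  Lipschitz-∙ : ∀ {n} {P Q : Map n} → Lipschitz P → Lipschitz Q → Lipschitz (pointwise P Q)
  Lipschitz-∙ (lˡ , lʳ) (lˡ′ , lʳ′) =
      (λ i i′ j le → subst₂ ℚ._≤_ (sym (shift (ℚ.+-monoʳ-≤ (val i)) _ _)) (sym (shift (ℚ.+-monoˡ-≤ (val i′)) _ _))
        (mono (lˡ i i′ j le) (lˡ′ i i′ j le)))
    , (λ i j j′ le → subst₂ ℚ._≤_ (sym (shift (ℚ.+-monoˡ-≤ (val j)) _ _)) (sym (shift (ℚ.+-monoˡ-≤ (val j′)) _ _))
        (mono (lʳ i j j′ le) (lʳ′ i j j′ le)))

  quasiCopula-∙ : ∀ {n} {P Q : Map n} → IsDiscreteQuasiCopula P → IsDiscreteQuasiCopula Q →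
    IsDiscreteQuasiCopula (pointwise P Q)
  quasiCopula-∙ {n} p q = Lipschitz⇒quasiCopula
    (λ i j → ∙-elim (λ x → 0ℚ ℚ.≤ x × x ℚ.≤ (+ n / 1)) (P.bounded i j) (Q.bounded i j))
    (record
      { zeroʳ = λ i → ∙-elim (_≡ 0ℚ) (PB.zeroʳ i) (QB.zeroʳ i)
      ; zeroˡ = λ i → ∙-elim (_≡ 0ℚ) (PB.zeroˡ i) (QB.zeroˡ i)
      ; topʳ  = λ i → ∙-elim (_≡ val i) (PB.topʳ i) (QB.topʳ i)
      ; topˡ  = λ i → ∙-elim (_≡ val i) (PB.topˡ i) (QB.topˡ i)
      })
    (monotone-∙ P.monotone Q.monotone)
    (Lipschitz-∙ (quasiCopula⇒Lipschitz p) (quasiCopula⇒Lipschitz q))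
    where
    module P = IsDiscreteQuasiCopula p
    module Q = IsDiscreteQuasiCopula q
    module PB = BoundaryConditions P.boundary
    module QB = BoundaryConditions Q.boundary

  𝒬-∙ : ∀ {n} {P Q : Map n} → 𝒬 n P → 𝒬 n Q → 𝒬 n (pointwise P Q)
  𝒬-∙ {n} {P} {Q} (p , pr) (q , qr) = pq , λ x → mk⇔
    (λ { (i , j , refl) → ∙-elim (λ y → ∃ λ k → val k ≡ y)
      (Equivalence.to (pr (P i j)) (i , j , refl))
      (Equivalence.to (qr (Q i j)) (i , j , refl)) })
    -- The column `j = n` already takes every value of `L n`.
    (λ { (k , refl) → k , fromℕ n , BoundaryConditions.topʳ (IsDiscreteQuasiCopula.boundary pq) k })
    where pq = quasiCopula-∙ p q

module Max = Pointwise ℚ._⊔_ ℚ.⊔-sel ℚ.⊔-mono-≤ ℚ.mono-≤-distrib-⊔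
module Min = Pointwise ℚ._⊓_ ℚ.⊓-sel ℚ.⊓-mono-≤ ℚ.mono-≤-distrib-⊓

𝒬-lattice : ∀ n → Lattice (induced (𝒬 n))
𝒬-lattice n =
    (λ (P , p) (Q , q) → Max.pointwise P Q , Max.𝒬-∙ p q)
  , (λ (P , p) (Q , q) → Min.pointwise P Q , Min.𝒬-∙ p q)
  , record
    { isPartialOrder = Poset.isPartialOrder (induced (𝒬 n))
    ; supremum = λ (P , _) (Q , _) →
          (λ i j → ℚ.p≤p⊔q (P i j) (Q i j))
        , (λ i j → ℚ.p≤q⊔p (P i j) (Q i j))
        , (λ _ P≤R Q≤R i j → ℚ.⊔-lub (P≤R i j) (Q≤R i j))
    ; infimum = λ (P , _) (Q , _) →
          (λ i j → ℚ.p⊓q≤p (P i j) (Q i j))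
        , (λ i j → ℚ.p⊓q≤q (P i j) (Q i j))
        , (λ _ R≤P R≤Q i j → ℚ.⊓-glb (R≤P i j) (R≤Q i j))
    }

-- Joins determined by pointwise bounds

-- The join lies above the pointwise maximum of `a` and `b` and below the pointwise minimum of `c`
-- and `d`; the two disjunctions close this gap at `p`. Here `p` is only a map, and in both
-- applications it lies outside `S`.
join-squeezed : ∀ {n} {S : Pred (Map n) 0ℓ} → Lattice (induced S) →
  ∀ (p : Map n) {a b c d : Map n} → S a → S b → S c → S d →
  (∀ i j → a i j ℚ.≤ p i j) → (∀ i j → b i j ℚ.≤ p i j) →
  (∀ i j → p i j ℚ.≤ c i j) → (∀ i j → p i j ℚ.≤ d i j) →
  (∀ i j → p i j ℚ.≤ a i j ⊎ p i j ℚ.≤ b i j) →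
  (∀ i j → c i j ℚ.≤ p i j ⊎ d i j ℚ.≤ p i j) →
  ∃ λ J → S J × (∀ i j → J i j ≡ p i j)
join-squeezed (_∨_ , _ , isLattice) p {a} {b} {c} {d} Sa Sb Sc Sd a≤p b≤p p≤c p≤d p≤a∨b c∧d≤p =
  proj₁ J , proj₂ J , λ i j → ℚ.≤-antisym
    (Sum.[ ℚ.≤-trans (J≤c i j) , ℚ.≤-trans (J≤d i j) ]′ (c∧d≤p i j))
    (Sum.[ flip ℚ.≤-trans (a≤J i j) , flip ℚ.≤-trans (b≤J i j) ]′ (p≤a∨b i j))
  where
  open IsLattice isLattice
  J = (a , Sa) ∨ (b , Sb)
  a≤J = x≤x∨y (a , Sa) (b , Sb)
  b≤J = y≤x∨y (a , Sa) (b , Sb)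
  J≤c = ∨-least {a , Sa} {b , Sb} {c , Sc}
    (λ i j → ℚ.≤-trans (a≤p i j) (p≤c i j)) (λ i j → ℚ.≤-trans (b≤p i j) (p≤c i j))
  J≤d = ∨-least {a , Sa} {b , Sb} {d , Sd}
    (λ i j → ℚ.≤-trans (a≤p i j) (p≤d i j)) (λ i j → ℚ.≤-trans (b≤p i j) (p≤d i j))

-- A join is known to agree with an explicit map only pointwise, so being a copula has to be
-- transported along such agreement.
copula-resp-≗ : ∀ {n} {P Q : Map n} → (∀ i j → P i j ≡ Q i j) → IsDiscreteCopula P → IsDiscreteCopula Q
copula-resp-≗ {n} P≗Q p = record
  { bounded = λ i j → subst (λ x → 0ℚ ℚ.≤ x × x ℚ.≤ (+ n / 1)) (P≗Q i j) (bounded i j)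
  ; boundary = record
    { zeroʳ = λ i → trans (sym (P≗Q _ _)) (zeroʳ i)
    ; zeroˡ = λ i → trans (sym (P≗Q _ _)) (zeroˡ i)
    ; topʳ  = λ i → trans (sym (P≗Q _ _)) (topʳ i)
    ; topˡ  = λ i → trans (sym (P≗Q _ _)) (topˡ i)
    }
  ; 2-increasing = λ i i′ j j′ i≤i′ j≤j′ → subst₂ ℚ._≤_
      (cong₂ ℚ._+_ (P≗Q i j′) (P≗Q i′ j)) (cong₂ ℚ._+_ (P≗Q i j) (P≗Q i′ j′))
      (2-increasing i i′ j j′ i≤i′ j≤j′)
  }
  where
  open IsDiscreteCopula p
  open BoundaryConditions boundary

-- From unit squares of an array of naturals to rectangles

-- Monotonicity, the Lipschitz condition and the rectangle inequality all compare increments;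
-- the inequalities are arranged so that no truncated subtraction occurs.
increments-≤ : ∀ (g h : ℕ → ℕ) → (∀ i → g (suc i) + h i ≤ g i + h (suc i)) →
  ∀ {i i′} → i ≤ i′ → g i′ + h i ≤ g i + h i′
increments-≤ g h step = go ∘ ℕ.≤⇒≤′
  where
  open ℕ.≤-Reasoning
  rearrange : ∀ a b c d → (a + b) + (c + d) ≡ (b + c) + (a + d)
  rearrange = solve-∀
  rearrange′ : ∀ a b c d → (a + b) + (c + d) ≡ (d + a) + (c + b)
  rearrange′ = solve-∀
  go : ∀ {i i′} → i ≤′ i′ → g i′ + h i ≤ g i + h i′
  go ≤′-refl = ℕ.≤-refl
  go {i} (≤′-step {i′} le) = ℕ.+-cancelˡ-≤ (h i′ + g i′) _ _ (begin
    (h i′ + g i′) + (g (suc i′) + h i)    ≡⟨ rearrange (g (suc i′)) (h i′) (g i′) (h i) ⟨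
    (g (suc i′) + h i′) + (g i′ + h i)    ≤⟨ ℕ.+-mono-≤ (step i′) (go le) ⟩
    (g i′ + h (suc i′)) + (g i + h i′)    ≡⟨ rearrange′ (g i′) (h (suc i′)) (g i) (h i′) ⟩
    (h i′ + g i′) + (g i + h (suc i′))    ∎)

Local : (ℕ → ℕ → ℕ → ℕ → Set) → (ℕ → ℕ → ℕ) → ℕ → ℕ → Set
Local R f i j = R (f i j) (f i (suc j)) (f (suc i) j) (f (suc i) (suc j))

-- The arguments are the corners of a unit square, row by row. In the second relation the two edges
-- leaving the first corner rise by 0 or 1; over all squares this reaches every unit edge.
CopulaSquare QuasiCopulaSquare : ℕ → ℕ → ℕ → ℕ → Set
CopulaSquare a b c d = b + c ≤ a + d
QuasiCopulaSquare a b c _ = (a ≤ b × b ≤ suc a) × (a ≤ c × c ≤ suc a)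

⟦_⟧ : (ℕ → ℕ → ℕ) → ∀ {n} → Map n
⟦ f ⟧ i j = ι (f (toℕ i) (toℕ j))

-- The bound `≤-min` by the largest copula yields both the zero edges and the upper bound `n`.
record Margins (f : ℕ → ℕ → ℕ) (n : ℕ) : Set where
  field
    ≤-min : ∀ i j → f i j ≤ i ⊓ j
    topʳ  : ∀ i → i ≤ n → f i n ≡ i
    topˡ  : ∀ j → j ≤ n → f n j ≡ j

module _ {f : ℕ → ℕ → ℕ} {n : ℕ} (margins : Margins f n) where
  open Margins margins

  value≤n : ∀ (i j : L n) → f (toℕ i) (toℕ j) ≤ n
  value≤n i j = ℕ.≤-trans (≤-min (toℕ i) (toℕ j)) (ℕ.≤-trans (ℕ.m⊓n≤m _ _) (Fin.toℕ≤pred[n] i))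

  ⟦⟧-bounded : Bounded {n} ⟦ f ⟧
  ⟦⟧-bounded i j = ι-mono-≤ 0 (f (toℕ i) (toℕ j)) z≤n , ι-mono-≤ (f (toℕ i) (toℕ j)) n (value≤n i j)

  ⟦⟧-boundary : BoundaryConditions {n} ⟦ f ⟧
  ⟦⟧-boundary = record
    { zeroʳ = λ i → cong ι (ℕ.n≤0⇒n≡0 (ℕ.≤-trans (≤-min (toℕ i) 0) (ℕ.m⊓n≤n (toℕ i) 0)))
    ; zeroˡ = λ i → cong ι (ℕ.n≤0⇒n≡0 (≤-min 0 (toℕ i)))
    ; topʳ  = λ i → cong ι (trans (cong (f (toℕ i)) (Fin.toℕ-fromℕ n)) (topʳ (toℕ i) (Fin.toℕ≤pred[n] i)))
    ; topˡ  = λ i → cong ι (trans (cong (λ k → f k (toℕ i)) (Fin.toℕ-fromℕ n)) (topˡ (toℕ i) (Fin.toℕ≤pred[n] i)))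
    }

  ⟦⟧-irreducible : IsIrreducible {n} ⟦ f ⟧
  ⟦⟧-irreducible q = mk⇔
    (λ { (i , j , refl) → fromℕ< (s≤s (value≤n i j)) , cong ι (Fin.toℕ-fromℕ< (s≤s (value≤n i j))) })
    (λ { (k , refl) → k , fromℕ n , BoundaryConditions.topʳ ⟦⟧-boundary k })

  ⟦⟧-copula : (∀ i j → Local CopulaSquare f i j) → IsDiscreteCopula {n} ⟦ f ⟧
  ⟦⟧-copula square = record
    { bounded = ⟦⟧-bounded
    ; boundary = ⟦⟧-boundary
    ; 2-increasing = λ i i′ j j′ i≤i′ j≤j′ →
        ι-mono-+-≤ (f (toℕ i) (toℕ j′)) (f (toℕ i′) (toℕ j)) (f (toℕ i) (toℕ j)) (f (toℕ i′) (toℕ j′))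
          (rectangle i≤i′ j≤j′)
    }
    where
    rectangle : ∀ {i i′ j j′} → i ≤ i′ → j ≤ j′ → f i j′ + f i′ j ≤ f i j + f i′ j′
    -- The inner use of `increments-≤` joins unit squares into a strip between rows `k` and `suc k`;
    -- the outer use stacks the strips from `i` to `i′`.
    rectangle {i} {i′} {j} {j′} i≤i′ j≤j′ = subst (_≤ f i j + f i′ j′) (ℕ.+-comm (f i′ j) (f i j′))
      (increments-≤ (λ k → f k j) (λ k → f k j′) (λ k →
        subst (_≤ f k j + f (suc k) j′) (ℕ.+-comm (f k j′) (f (suc k) j))
          (increments-≤ (f k) (f (suc k)) (square k) j≤j′)) i≤i′)

  ⟦⟧-quasiCopula : (∀ i j → Local QuasiCopulaSquare f i j) → IsDiscreteQuasiCopula {n} ⟦ f ⟧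
  ⟦⟧-quasiCopula square = Lipschitz⇒quasiCopula ⟦⟧-bounded ⟦⟧-boundary
    -- Monotonicity compares increments with those of a constant, the Lipschitz condition with those
    -- of the identity.
    ( (λ i i′ j le → ι-mono-≤ (f (toℕ i) (toℕ j)) (f (toℕ i′) (toℕ j))
        (increments-≤ (λ _ → 0) (λ k → f k (toℕ j)) (λ k → proj₁ (proj₂ (square k (toℕ j)))) le))
    , (λ i j j′ le → ι-mono-≤ (f (toℕ i) (toℕ j)) (f (toℕ i) (toℕ j′))
        (increments-≤ (λ _ → 0) (f (toℕ i)) (λ k → proj₁ (proj₁ (square (toℕ i) k))) le)) )
    ( (λ i i′ j le → ι-mono-+-≤ (toℕ i) (f (toℕ i′) (toℕ j)) (f (toℕ i) (toℕ j)) (toℕ i′)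
        (subst (_≤ f (toℕ i) (toℕ j) + toℕ i′) (ℕ.+-comm (f (toℕ i′) (toℕ j)) (toℕ i))
          (increments-≤ (λ k → f k (toℕ j)) (λ k → k) (λ k → slope k (proj₂ (proj₂ (square k (toℕ j))))) le)))
    , (λ i j j′ le → ι-mono-+-≤ (f (toℕ i) (toℕ j′)) (toℕ j) (f (toℕ i) (toℕ j)) (toℕ j′)
        (increments-≤ (f (toℕ i)) (λ k → k) (λ k → slope k (proj₂ (proj₁ (square (toℕ i) k)))) le)) )
    where
    slope : ∀ {x y} k → y ≤ suc x → y + k ≤ x + suc k
    slope {x} {y} k y≤1+x = subst (y + k ≤_) (sym (ℕ.+-suc x k)) (ℕ.+-monoˡ-≤ k y≤1+x)

-- For `i ≤ j` the right side is `i + suc i`, and each minimum on the left is bounded by its row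
-- index; for `j ≤ i` the column indices serve.
min-copulaSquare : ∀ i j → Local CopulaSquare _⊓_ i j
min-copulaSquare i j with ℕ.≤-total i j
... | inj₁ i≤j rewrite ℕ.m≤n⇒m⊓n≡m i≤j = ℕ.+-mono-≤ (ℕ.m⊓n≤m i (suc j)) (ℕ.m⊓n≤m (suc i) j)
... | inj₂ j≤i rewrite ℕ.m≥n⇒m⊓n≡n j≤i = subst (i ⊓ suc j + suc i ⊓ j ≤_) (ℕ.+-comm (suc j) j)
  (ℕ.+-mono-≤ (ℕ.m⊓n≤n i (suc j)) (ℕ.m⊓n≤n (suc i) j))

min-quasiCopulaSquare : ∀ i j → Local QuasiCopulaSquare _⊓_ i j
min-quasiCopulaSquare i j =
    (ℕ.⊓-monoʳ-≤ i (ℕ.n≤1+n j) , ℕ.⊓-monoˡ-≤ (suc j) (ℕ.n≤1+n i))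
  , (ℕ.⊓-monoˡ-≤ j (ℕ.n≤1+n i) , ℕ.⊓-monoʳ-≤ (suc i) (ℕ.n≤1+n j))

-- Lowering the minimum on a finite set of points

Points : Set
Points = List (ℕ × ℕ)

-- Since `pred` is truncated at 0, the zero edges survive for every list of points.
lowered : Points → ℕ → ℕ → ℕ
lowered S i j = if does ((i , j) ∈? S) then pred (i ⊓ j) else i ⊓ j

lowered-∈ : ∀ {S i j} → (i , j) ∈ S → lowered S i j ≡ pred (i ⊓ j)
lowered-∈ {S} {i} {j} ij∈S rewrite dec-true ((i , j) ∈? S) ij∈S = refl

lowered-∉ : ∀ {S i j} → (i , j) ∉ S → lowered S i j ≡ i ⊓ j
lowered-∉ {S} {i} {j} ij∉S rewrite dec-false ((i , j) ∈? S) ij∉S = refl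

lowered≤min : ∀ S i j → lowered S i j ≤ i ⊓ j
lowered≤min S i j with does ((i , j) ∈? S)
... | true  = ℕ.pred[n]≤n
... | false = ℕ.≤-refl

lowered≥pred-min : ∀ S i j → pred (i ⊓ j) ≤ lowered S i j
lowered≥pred-min S i j with does ((i , j) ∈? S)
... | true  = ℕ.≤-refl
... | false = ℕ.pred[n]≤n

lowered-antitone : ∀ {S T} → All (_∈ T) S → ∀ i j → lowered T i j ≤ lowered S i j
lowered-antitone {S} {T} S⊆T i j with (i , j) ∈? S
... | yes ij∈S = ℕ.≤-reflexive (lowered-∈ {T} (All.lookup S⊆T ij∈S))
... | no  _    = lowered≤min T i j

-- The bound is strict, so for every `n ≥ k` the top edges avoid the points.
Within : ℕ → Points → Set
Within k = All λ (i , j) → i < k × j < k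

within? : ∀ k → Decidable (Within k)
within? k = All.all? λ (i , j) → (i ℕ.<? k) ×-dec (j ℕ.<? k)

outside : ∀ {k S i j} → Within k S → k ≤ i ⊎ k ≤ j → lowered S i j ≡ i ⊓ j
outside {S = S} within far = lowered-∉ {S} λ ij∈S → case far of λ where
  (inj₁ k≤i) → ℕ.<⇒≱ (proj₁ (All.lookup within ij∈S)) k≤i
  (inj₂ k≤j) → ℕ.<⇒≱ (proj₂ (All.lookup within ij∈S)) k≤j

lowered-margins : ∀ {k n S} → Within k S → k ≤ n → Margins (lowered S) n
lowered-margins {S = S} within k≤n = record
  { ≤-min = lowered≤min S
  ; topʳ = λ i i≤n → trans (outside within (inj₂ k≤n)) (ℕ.m≤n⇒m⊓n≡m i≤n)
  ; topˡ = λ j j≤n → trans (outside within (inj₁ k≤n)) (ℕ.m≥n⇒m⊓n≡n j≤n)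
  }

-- If the first corner of a unit square is outside the `k` by `k` corner, so are the other three,
-- and the square is one of the minimum.
local-outside : ∀ R {k S i j} → (∀ i j → Local R _⊓_ i j) → Within k S →
  k ≤ i ⊎ k ≤ j → Local R (lowered S) i j
local-outside R {S = S} {i} {j} min-local within far
  rewrite outside {S = S} {i} {j} within far
        | outside {S = S} {i} {suc j} within (Sum.map₂ ℕ.m≤n⇒m≤1+n far)
        | outside {S = S} {suc i} {j} within (Sum.map₁ ℕ.m≤n⇒m≤1+n far)
        | outside {S = S} {suc i} {suc j} within (Sum.map ℕ.m≤n⇒m≤1+n ℕ.m≤n⇒m≤1+n far)
  = min-local i j

-- Reduction to finitely many decidable conditions

Squares : (ℕ → ℕ → ℕ → ℕ → Set) → ℕ → Points → Set
Squares R k S = ∀ (i j : Fin k) → Local R (lowered S) (toℕ i) (toℕ j)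

squares⇒local : ∀ R {k S} → (∀ i j → Local R _⊓_ i j) → Within k S → Squares R k S →
  ∀ i j → Local R (lowered S) i j
squares⇒local R {k} {S} min-local within squares i j with i ℕ.<? k | j ℕ.<? k
... | no i≮k | _ = local-outside R {S = S} min-local within (inj₁ (ℕ.≮⇒≥ i≮k))
... | _ | no j≮k = local-outside R {S = S} min-local within (inj₂ (ℕ.≮⇒≥ j≮k))
... | yes i<k | yes j<k = subst₂ (Local R (lowered S)) (Fin.toℕ-fromℕ< i<k) (Fin.toℕ-fromℕ< j<k)
  (squares (fromℕ< i<k) (fromℕ< j<k))

CopulaPoints QuasiCopulaPoints Violating ProperPoints : ℕ → Points → Set
CopulaPoints k S = Within k S × Squares CopulaSquare k S
QuasiCopulaPoints k S = Within k S × Squares QuasiCopulaSquare k S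
Violating k S = ∃₂ λ (i j : Fin k) → ¬ Local CopulaSquare (lowered S) (toℕ i) (toℕ j)
ProperPoints k S = QuasiCopulaPoints k S × Violating k S

copulaSquare? : ∀ a b c d → Dec (CopulaSquare a b c d)
copulaSquare? a b c d = b + c ℕ.≤? a + d

quasiCopulaSquare? : ∀ a b c d → Dec (QuasiCopulaSquare a b c d)
quasiCopulaSquare? a b c _ =
  ((a ℕ.≤? b) ×-dec (b ℕ.≤? suc a)) ×-dec ((a ℕ.≤? c) ×-dec (c ℕ.≤? suc a))

local? : ∀ R → (∀ a b c d → Dec (R a b c d)) → ∀ f i j → Dec (Local R f i j)
local? R R? f i j = R? (f i j) (f i (suc j)) (f (suc i) j) (f (suc i) (suc j))

squares? : ∀ R → (∀ a b c d → Dec (R a b c d)) → ∀ k → Decidable (Squares R k)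
squares? R R? k S = Fin.all? λ i → Fin.all? λ j → local? R R? (lowered S) (toℕ i) (toℕ j)

copulaPoints? : ∀ k → Decidable (CopulaPoints k)
copulaPoints? k S = within? k S ×-dec squares? CopulaSquare copulaSquare? k S

violating? : ∀ k → Decidable (Violating k)
violating? k S = Fin.any? λ i → Fin.any? λ j →
  ¬? (local? CopulaSquare copulaSquare? (lowered S) (toℕ i) (toℕ j))

properPoints? : ∀ k → Decidable (ProperPoints k)
properPoints? k S = (within? k S ×-dec squares? QuasiCopulaSquare quasiCopulaSquare? k S) ×-dec violating? k S

lowered-copula : ∀ S {k n} → k ≤ n → CopulaPoints k S → IsDiscreteCopula {n} ⟦ lowered S ⟧
lowered-copula S k≤n (within , squares) =
  ⟦⟧-copula (lowered-margins {S = S} within k≤n)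
    (squares⇒local CopulaSquare {S = S} min-copulaSquare within squares)

lowered-𝒫 : ∀ S {k n} → k ≤ n → CopulaPoints k S → 𝒫 n ⟦ lowered S ⟧
lowered-𝒫 S k≤n points@(within , _) = lowered-copula S k≤n points ,
  ⟦⟧-irreducible (lowered-margins {S = S} within k≤n)

violating⇒¬copula : ∀ S {k n} → k ≤ n → Violating k S → ¬ IsDiscreteCopula {n} ⟦ lowered S ⟧
violating⇒¬copula S {k} {n} k≤n (i , j , ¬square) copula = ¬square
  -- As `i` and `j` are below `k ≤ n`, the whole square fits into `L n`. The inner `subst₂` removes
  -- `inject₁`, the outer one `inject≤`.
  (subst₂ (Local CopulaSquare f) (Fin.toℕ-inject≤ i k≤n) (Fin.toℕ-inject≤ j k≤n)
    (subst₂ (λ x y → f x (suc (toℕ j′)) + f (suc (toℕ i′)) y ≤ f x y + f (suc (toℕ i′)) (suc (toℕ j′)))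
      (Fin.toℕ-inject₁ i′) (Fin.toℕ-inject₁ j′)
      (ι-cancel-+-≤
        (f (toℕ (Fin.inject₁ i′)) (suc (toℕ j′))) (f (suc (toℕ i′)) (toℕ (Fin.inject₁ j′)))
        (f (toℕ (Fin.inject₁ i′)) (toℕ (Fin.inject₁ j′))) (f (suc (toℕ i′)) (suc (toℕ j′)))
        (IsDiscreteCopula.2-increasing copula (Fin.inject₁ i′) (Fin.suc i′) (Fin.inject₁ j′) (Fin.suc j′)
          (below i′) (below j′)))))
  where
  f = lowered S
  i′ = Fin.inject≤ i k≤n
  j′ = Fin.inject≤ j k≤n
  below : ∀ (x : Fin n) → Fin.inject₁ x Fin.≤ Fin.suc x
  below x = subst (_≤ suc (toℕ x)) (sym (Fin.toℕ-inject₁ x)) (ℕ.n≤1+n (toℕ x))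

lowered-proper : ∀ S {k n} → k ≤ n → ProperPoints k S → (𝒬 n ∖ 𝒫 n) ⟦ lowered S ⟧
lowered-proper S k≤n ((within , squares) , violating) =
    ( ⟦⟧-quasiCopula margins (squares⇒local QuasiCopulaSquare {S = S} min-quasiCopulaSquare within squares)
    , ⟦⟧-irreducible margins )
  , λ (copula , _) → violating⇒¬copula S k≤n violating copula
  where margins = lowered-margins {S = S} within k≤n

-- Squeezed sets of points

-- Larger sets give smaller maps, so the pointwise maximum becomes `a ∩ b = p` and the pointwise
-- minimum becomes `c ∪ d = p`.
record Squeezed (p a b c d : Points) : Set where
  constructor squeezed
  field
    p⊆a   : All (_∈ a) p
    p⊆b   : All (_∈ b) p
    c⊆p   : All (_∈ p) c
    d⊆p   : All (_∈ p) d
    a∩b⊆p : All (λ x → x ∈ b → x ∈ p) a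
    p⊆c∪d : All (λ x → x ∈ c ⊎ x ∈ d) p

squeezed? : ∀ p a b c d → Dec (Squeezed p a b c d)
squeezed? p a b c d = map′
  (λ (x₁ , x₂ , x₃ , x₄ , x₅ , x₆) → squeezed x₁ x₂ x₃ x₄ x₅ x₆)
  (λ (squeezed x₁ x₂ x₃ x₄ x₅ x₆) → x₁ , x₂ , x₃ , x₄ , x₅ , x₆)
  (All.all? (_∈? a) p ×-dec All.all? (_∈? b) p ×-dec All.all? (_∈? p) c ×-dec All.all? (_∈? p) d
    ×-dec All.all? (λ x → (x ∈? b) →-dec (x ∈? p)) a
    ×-dec All.all? (λ x → (x ∈? c) ⊎-dec (x ∈? d)) p)

lowered-squeezed : ∀ {n p a b c d} {X : Pred (Map n) 0ℓ} → Squeezed p a b c d → Lattice (induced X) →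
  X ⟦ lowered a ⟧ → X ⟦ lowered b ⟧ → X ⟦ lowered c ⟧ → X ⟦ lowered d ⟧ →
  ∃ λ J → X J × (∀ i j → J i j ≡ ⟦ lowered p ⟧ i j)
lowered-squeezed {n} {p} {a} {b} {c} {d} sq lattice Xa Xb Xc Xd =
  join-squeezed lattice ⟦ lowered p ⟧ Xa Xb Xc Xd
    (antitone p⊆a) (antitone p⊆b) (antitone c⊆p) (antitone d⊆p)
    (λ i j → Sum.map (below p a i j) (below p b i j) (p≤a⊎b (toℕ i) (toℕ j)))
    (λ i j → Sum.map (below c p i j) (below d p i j) (c⊎d≤p (toℕ i) (toℕ j)))
  where
  open Squeezed sq
  below : ∀ S T (i j : L n) → lowered S (toℕ i) (toℕ j) ≤ lowered T (toℕ i) (toℕ j) →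
    ⟦ lowered S ⟧ i j ℚ.≤ ⟦ lowered T ⟧ i j
  below S T i j = ι-mono-≤ (lowered S (toℕ i) (toℕ j)) (lowered T (toℕ i) (toℕ j))
  antitone : ∀ {S T} → All (_∈ T) S → ∀ (i j : L n) → ⟦ lowered T ⟧ i j ℚ.≤ ⟦ lowered S ⟧ i j
  antitone {S} {T} S⊆T i j = below T S i j (lowered-antitone S⊆T (toℕ i) (toℕ j))
  below-∉ : ∀ {S i j} → (i , j) ∉ S → lowered p i j ≤ lowered S i j
  below-∉ {S} {i} {j} ij∉S = subst (lowered p i j ≤_) (sym (lowered-∉ {S} ij∉S)) (lowered≤min p i j)
  p≤a⊎b : ∀ i j → lowered p i j ≤ lowered a i j ⊎ lowered p i j ≤ lowered b i j
  -- Off `a` or off `b` that map keeps the full minimum; on both, the point is in `p`, where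
  -- `lowered p` has the least possible value.
  p≤a⊎b i j = case ((i , j) ∈? a) , ((i , j) ∈? b) of λ where
    (no ij∉a , _) → inj₁ (below-∉ {a} ij∉a)
    (_ , no ij∉b) → inj₂ (below-∉ {b} ij∉b)
    (yes ij∈a , yes ij∈b) → inj₁ (subst (_≤ lowered a i j)
      (sym (lowered-∈ {p} (All.lookup a∩b⊆p ij∈a ij∈b))) (lowered≥pred-min a i j))
  above-∈ : ∀ {S i j} → (i , j) ∈ S → lowered S i j ≤ lowered p i j
  above-∈ {S} {i} {j} ij∈S = subst (_≤ lowered p i j) (sym (lowered-∈ {S} ij∈S)) (lowered≥pred-min p i j)
  c⊎d≤p : ∀ i j → lowered c i j ≤ lowered p i j ⊎ lowered d i j ≤ lowered p i j
  c⊎d≤p i j = case ((i , j) ∈? p) of λ where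
    (yes ij∈p) → Sum.map (above-∈ {c}) (above-∈ {d}) (All.lookup p⊆c∪d ij∈p)
    (no  ij∉p) → inj₁ (subst (lowered c i j ≤_) (sym (lowered-∉ {p} ij∉p)) (lowered≤min c i j))

-- On the 3 × 3 corner (the rest of the matrix is the identity), a and b are the permutations 231 and 312, c and d are 213 and 132,
-- and p is the alternating sign matrix that is not a permutation.
module CopulaExample where
  a b c d p : Points
  a = (1 , 1) ∷ (2 , 1) ∷ (2 , 2) ∷ []
  b = (1 , 1) ∷ (1 , 2) ∷ (2 , 2) ∷ []
  c = (1 , 1) ∷ []
  d = (2 , 2) ∷ []
  p = (1 , 1) ∷ (2 , 2) ∷ []

  squeeze : Squeezed p a b c d
  squeeze = from-yes (squeezed? p a b c d)

  a-copula : CopulaPoints 3 a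
  a-copula = from-yes (copulaPoints? 3 a)

  b-copula : CopulaPoints 3 b
  b-copula = from-yes (copulaPoints? 3 b)

  c-copula : CopulaPoints 3 c
  c-copula = from-yes (copulaPoints? 3 c)

  d-copula : CopulaPoints 3 d
  d-copula = from-yes (copulaPoints? 3 d)

  -- The square with first corner (1,1) has values 0, 1, 1, 1, hence mass -1.
  p-violating : Violating 3 p
  p-violating = from-yes (violating? 3 p)

𝒫-not-lattice : ∀ n → n ≥ 3 → ¬ Lattice (induced (𝒫 n))
𝒫-not-lattice n n≥3 lattice =
  let J , (J-copula , _) , J≗p = lowered-squeezed squeeze lattice
        (lowered-𝒫 a n≥3 a-copula) (lowered-𝒫 b n≥3 b-copula)
        (lowered-𝒫 c n≥3 c-copula) (lowered-𝒫 d n≥3 d-copula)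
  in violating⇒¬copula p n≥3 p-violating (copula-resp-≗ J≗p J-copula)
  where open CopulaExample

-- On the 4 × 4 corner, likewise, p is the permutation 3142.
module ProperExample where
  a b c d p : Points
  a = (2 , 1) ∷ p
  b = (2 , 3) ∷ p
  -- `c` and `d` arise from `p` by dropping (3,2) and (1,2) respectively.
  c = (1 , 1) ∷ (1 , 2) ∷ (2 , 2) ∷ (3 , 3) ∷ []
  d = (1 , 1) ∷ (2 , 2) ∷ (3 , 2) ∷ (3 , 3) ∷ []
  p = (1 , 1) ∷ (1 , 2) ∷ (2 , 2) ∷ (3 , 2) ∷ (3 , 3) ∷ []

  squeeze : Squeezed p a b c d
  squeeze = from-yes (squeezed? p a b c d)

  -- A square of mass -1 has its first corner at (2,1) for `a`, (1,2) for `b`, (2,2) for `c` and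
  -- (1,1) for `d`.
  a-proper : ProperPoints 4 a
  a-proper = from-yes (properPoints? 4 a)

  b-proper : ProperPoints 4 b
  b-proper = from-yes (properPoints? 4 b)

  c-proper : ProperPoints 4 c
  c-proper = from-yes (properPoints? 4 c)

  d-proper : ProperPoints 4 d
  d-proper = from-yes (properPoints? 4 d)

  p-copula : CopulaPoints 4 p
  p-copula = from-yes (copulaPoints? 4 p)

𝒬∖𝒫-not-lattice : ∀ n → n ≥ 4 → ¬ Lattice (induced (𝒬 n ∖ 𝒫 n))
𝒬∖𝒫-not-lattice n n≥4 lattice =
  let J , ((_ , J-irreducible) , J∉𝒫) , J≗p = lowered-squeezed squeeze lattice
        (lowered-proper a n≥4 a-proper) (lowered-proper b n≥4 b-proper)
        (lowered-proper c n≥4 c-proper) (lowered-proper d n≥4 d-proper)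
  -- Agreement with the copula `p` would make the join a copula, although it was taken among the
  -- proper quasi-copulas.
  in J∉𝒫 (copula-resp-≗ (λ i j → sym (J≗p i j)) (lowered-copula p n≥4 p-copula) , J-irreducible)
  where open ProperExample

theorem2 : (∀ (n : ℕ) → n ≥ 1 → Lattice (induced (𝒬 n)))
    × (∀ (n : ℕ) → n ≥ 3 → ¬ Lattice (induced (𝒫 n)))
    × (∀ (n : ℕ) → n ≥ 4 → ¬ Lattice (induced (𝒬 n ∖ 𝒫 n)))
theorem2 = (λ n _ → 𝒬-lattice n) , 𝒫-not-lattice , 𝒬∖𝒫-not-lattice
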